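{- For integers $N\ge 0$ and $i\ge 0$, the number of reversed partial ternary paths of length $3N+2i$ ending at level $i$ equals $$\sum_{0\le k\le i/2}\binom{i-k}{k}\left[\binom{3N+2i+1}{N+k}-3\binom{3N+2i}{N+k-1}\right],$$ with the convention $\binom{a}{b}=0$ for $b<0$.
   Context: A reversed partial ternary path of length $n$ is a lattice path $(0,c_0),\dots,(n,c_n)$ with $c_0=0$, each step being either $(1,2)$ or $(1,-1)$, never going below the $x$-axis; it ends at level $c_n$. Equivalently, these are final segments of ternary paths (steps $(1,1)$ and $(1,-2)$, staying weakly above the $x$-axis, ending on the $x$-axis) read from right to left. -}

module Defs where

open import Data.Fin.Base using (Fin; zero; suc; inject₁; fromℕ)
open import Data.Integer.Base using (ℤ; +_; -[1+_]; 0ℤ; 1ℤ; _+_; _-_; _*_; _≤_)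
open import Data.List.Base using (List; length; map; foldr; upTo)
open import Data.List.Membership.Propositional using (_∈_)
open import Data.List.Relation.Unary.Unique.Propositional using (Unique)
import Data.Nat.Base as ℕ
open ℕ using (ℕ)
open import Data.Nat.Combinatorics using (_C_)
open import Data.Product.Base using (Σ-syntax; _×_)
open import Data.Sum.Base using (_⊎_)
open import Data.Vec.Base using (Vec; lookup)
open import Function.Bundles using (_⇔_)
open import Relation.Binary.PropositionalEquality using (_≡_)

-- The path (0,c₀),…,(n,cₙ) is represented by its vector of levels c.
record IsReversedPartialTernaryPath {n : ℕ} (c : Vec ℤ (ℕ.suc n)) : Set where
  field
    starts-at-0 : lookup c zero ≡ 0ℤ
    steps       : (j : Fin n) →
                  (lookup c (suc j) ≡ lookup c (inject₁ j) + + 2) ⊎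
                  (lookup c (suc j) ≡ lookup c (inject₁ j) - 1ℤ)
    nonnegative : (j : Fin (ℕ.suc n)) → 0ℤ ≤ lookup c j

endLevel : {n : ℕ} → Vec ℤ (ℕ.suc n) → ℤ
endLevel {n} c = lookup c (fromℕ n)

ReversedPathEndingAt : (n i : ℕ) → Vec ℤ (ℕ.suc n) → Set
ReversedPathEndingAt n i c = IsReversedPartialTernaryPath c × endLevel c ≡ + i

-- Exactly m elements of A satisfy P: they are listed without repetition by
-- a list of length m.
HasCardinality : {A : Set} → (A → Set) → ℕ → Set
HasCardinality {A} P m =
  Σ[ xs ∈ List A ] (Unique xs × ((x : A) → (x ∈ xs) ⇔ P x) × length xs ≡ m)

-- _C_ already vanishes when the lower index exceeds the upper one.
binom : ℕ → ℤ → ℤ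
binom a (+ b)    = + (a C b)
binom a -[1+ _ ] = 0ℤ

-- Both bounds are inclusive: f 0 + … + f m.
sumUpTo : ℕ → (ℕ → ℤ) → ℤ
sumUpTo m f = foldr _+_ 0ℤ (map f (upTo (ℕ.suc m)))

pathFormula : (N i : ℕ) → ℤ
pathFormula N i = sumUpTo ℕ.⌊ i /2⌋ λ k →
  -- k ≤ i / 2 ≤ i, so the truncated i ∸ k is the true difference.
  binom (i ℕ.∸ k) (+ k) *
    (binom (3 ℕ.* N ℕ.+ 2 ℕ.* i ℕ.+ 1) (+ N + + k)
      - + 3 * binom (3 ℕ.* N ℕ.+ 2 ℕ.* i) (+ N + + k - 1ℤ))

{-# OPTIONS --safe #-}
-- With g n m = C(n+1,m) − 3 C(n,m−1), the formula at length n = 3M + 2j is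
-- F n j = Σₖ C(j−k,k) g n (M+k), where M may be negative.  The numbers C(j−k,k)
-- are the coefficients of the Fibonacci polynomials
-- S₀ = S₁ = 1, S_{j+2} = S_{j+1} + x S_j, which satisfy
-- (1+x) S_j = x² S_{j−2} + S_{j+1}; since g obeys Pascal's rule, F obeys the
-- last-step recurrence F (n+1) j = F n (j−2) + F n (j+1) of the path numbers.
-- Extending S backwards gives S₋₁ = 0 and S₋₂ = 1/x, so at the boundary j = 0 the
-- spurious term is g n M with n+1 = 3M, which vanishes because C(3M,M) = 3 C(3M−1,M−1).
module Submission where

open import Data.Bool.Base using (T; true; false; if_then_else_)
open import Data.Fin.Base using (Fin; zero; suc; inject₁)
open import Data.Nat.Base using (ℕ; zero; suc; _+_; _*_; _∸_; _≡ᵇ_; _≤_; _<_; z≤n; s≤s; ⌊_/2⌋)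
open import Data.Integer.Base using (ℤ; +_; -[1+_]; 0ℤ; 1ℤ)
import Data.Integer.Base as ℤ
import Data.Integer.Properties as ℤ
import Data.Integer.Tactic.RingSolver as ℤ-Solver
open import Data.List.Base using (List; []; _∷_; _++_; map; length; applyUpTo; foldr)
open import Data.List.Membership.Propositional using (_∈_)
open import Data.List.Membership.Propositional.Properties using (∈-map⁺; ∈-map⁻; ∈-++⁺ˡ; ∈-++⁺ʳ; ∈-++⁻)
open import Data.List.Properties using (length-map; length-++; map-upTo)
open import Data.List.Relation.Binary.Disjoint.Propositional using (Disjoint)
open import Data.List.Relation.Unary.All using ([])
open import Data.List.Relation.Unary.AllPairs using ([]; _∷_)
open import Data.List.Relation.Unary.Any using (here)
open import Data.List.Relation.Unary.Unique.Propositional using (Unique)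
import Data.List.Relation.Unary.Unique.Propositional.Properties as Unique
open import Data.Nat.Combinatorics using (_C_; nC1≡n; nCk+nC[k+1]≡[n+1]C[k+1])
open import Data.Nat.Properties using (+-comm; +-suc; +-identityʳ; *-comm; *-assoc; *-cancelˡ-≡; *-cancelʳ-<; 0∸n≡0; ≡ᵇ⇒≡; ≡⇒≡ᵇ; m≢1+n+m; m<n+m; n≤1+n; ≤-refl; ≤-trans; ⌊n/2⌋-mono; module ≤-Reasoning)
open import Data.Nat.Tactic.RingSolver using (solve-∀)
open import Data.Product.Base using (Σ-syntax; _×_; _,_)
import Data.Sum.Base as Sum
open Sum using (_⊎_; inj₁; inj₂)
open import Data.Vec.Base using (Vec; []; _∷_; lookup)
open import Data.Vec.Properties using (∷-injectiveʳ)
open import Data.Unit.Base using (tt)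
open import Function.Base using (_∘_)
open import Function.Bundles using (mk⇔)
open import Relation.Binary.PropositionalEquality using (_≡_; refl; sym; trans; cong; cong₂; subst; module ≡-Reasoning)
open import Defs

-- Enumeration of paths by their first step

-- Reads a sequence one place earlier, with a default at 0. Applied once to start levels it gives a
-- first down step, which level 0 does not admit; applied twice to end levels it gives a last up
-- step.
delay : {A : Set} → A → (ℕ → A) → ℕ → A
delay z f zero    = z
delay z f (suc s) = f s

paths : (n s i : ℕ) → List (Vec ℤ (suc n))
paths zero    s i = if s ≡ᵇ i then (+ s ∷ []) ∷ [] else []
paths (suc n) s i =
  map (+ s ∷_) (paths n (2 + s) i ++ delay [] (λ t → paths n t i) s)

count : (n s i : ℕ) → ℕ
count zero    s i = if s ≡ᵇ i then 1 else 0
count (suc n) s i = count n (2 + s) i + delay 0 (λ t → count n t i) s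

length-paths : ∀ n s i → length (paths n s i) ≡ count n s i
length-paths zero s i with s ≡ᵇ i
... | true  = refl
... | false = refl
length-paths (suc n) s i = trans (length-map (+ s ∷_) (paths n (2 + s) i ++ delay [] (λ t → paths n t i) s))
  (trans (length-++ (paths n (2 + s) i)) (cong₂ _+_ (length-paths n (2 + s) i) (down s)))
  where
  down : ∀ s → length (delay [] (λ t → paths n t i) s) ≡ delay 0 (λ t → count n t i) s
  down zero    = refl
  down (suc s) = length-paths n s i

-- With an arbitrary start level the tail of a path is again an instance, as induction on the first
-- step requires.
record PathFrom {n : ℕ} (s i : ℕ) (c : Vec ℤ (suc n)) : Set where
  constructor pathFrom
  field
    start       : lookup c zero ≡ + s
    steps       : (j : Fin n) →
                  (lookup c (suc j) ≡ lookup c (inject₁ j) ℤ.+ + 2) ⊎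
                  (lookup c (suc j) ≡ lookup c (inject₁ j) ℤ.- 1ℤ)
    nonnegative : (j : Fin (suc n)) → 0ℤ ℤ.≤ lookup c j
    end         : endLevel c ≡ + i

open PathFrom

PathFrom-∷ : ∀ {n s t i} {c : Vec ℤ (suc n)} → PathFrom t i c →
             (+ t ≡ + s ℤ.+ + 2) ⊎ (+ t ≡ + s ℤ.- 1ℤ) → PathFrom s i (+ s ∷ c)
PathFrom-∷ {n} {s} {t} {i} {c} p e = pathFrom refl st nn (end p)
  where
  st : (j : Fin (suc n)) → _
  st zero    = Sum.map (trans (start p)) (trans (start p)) e
  st (suc j) = steps p j
  nn : (j : Fin (suc (suc n))) → 0ℤ ℤ.≤ lookup (+ s ∷ c) j
  nn zero    = ℤ.+≤+ z≤n
  nn (suc j) = nonnegative p j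

paths-sound : ∀ n s i {c} → c ∈ paths n s i → PathFrom s i c
paths-sound zero s i c∈ with s ≡ᵇ i in eq
paths-sound zero s i (here refl) | true = pathFrom refl (λ ()) (λ { zero → ℤ.+≤+ z≤n })
  (cong +_ (≡ᵇ⇒≡ s i (subst T (sym eq) tt)))
paths-sound (suc n) s i c∈ with ∈-map⁻ (+ s ∷_) c∈
... | c , c∈′ , refl with ∈-++⁻ (paths n (2 + s) i) c∈′
...   | inj₁ up = PathFrom-∷ (paths-sound n (2 + s) i up) (inj₁ (cong +_ (+-comm 2 s)))
paths-sound (suc n) (suc s) i c∈ | c , c∈′ , refl | inj₂ down =
  PathFrom-∷ (paths-sound n s i down) (inj₂ refl)

paths-complete : ∀ n s i (c : Vec ℤ (suc n)) → PathFrom s i c → c ∈ paths n s i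
paths-complete zero s i (x ∷ []) p with trans (sym (start p)) (end p)
... | refl with s ≡ᵇ s | ≡⇒≡ᵇ s s refl
...   | true | _ = here (cong (_∷ []) (start p))
paths-complete (suc n) s i (x ∷ c) p with start p
... | refl = ∈-map⁺ (+ s ∷_) (first s p (steps p zero))
  where
  tail : ∀ {s t} → PathFrom s i (+ s ∷ c) → lookup c zero ≡ + t → PathFrom t i c
  tail p e = pathFrom e (λ j → steps p (suc j)) (λ j → nonnegative p (suc j)) (end p)
  first : ∀ s → PathFrom s i (+ s ∷ c) →
          (lookup c zero ≡ + s ℤ.+ + 2) ⊎ (lookup c zero ≡ + s ℤ.- 1ℤ) →
          c ∈ paths n (2 + s) i ++ delay [] (λ t → paths n t i) s
  first s p (inj₁ up) =
    ∈-++⁺ˡ (paths-complete n (2 + s) i c (tail p (trans up (cong +_ (+-comm s 2)))))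
  -- After a down step from level 0, nonnegativity would demand that -1 be at least 0.
  first zero p (inj₂ down) with subst (0ℤ ℤ.≤_) down (nonnegative p (suc zero))
  ... | ()
  first (suc s) p (inj₂ down) =
    ∈-++⁺ʳ (paths n (3 + s) i) (paths-complete n s i c (tail p down))

-- The tails after an up step and after a down step start three levels apart, so the two lists
-- cannot overlap.
paths-unique : ∀ n s i → Unique (paths n s i)
paths-unique zero s i with s ≡ᵇ i
... | true  = [] ∷ []
... | false = []
paths-unique (suc n) s i =
  Unique.map⁺ ∷-injectiveʳ (Unique.++⁺ (paths-unique n (2 + s) i) (unique s) (disjoint s))
  where
  unique : ∀ s → Unique (delay [] (λ t → paths n t i) s)
  unique zero    = []
  unique (suc s) = paths-unique n s i
  disjoint : ∀ s → Disjoint (paths n (2 + s) i) (delay [] (λ t → paths n t i) s)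
  disjoint (suc s) (up , down) = m≢1+n+m s {2} (ℤ.+-injective
    (trans (sym (start (paths-sound n s i down))) (start (paths-sound n (3 + s) i up))))

paths-cardinality : ∀ n i → HasCardinality (ReversedPathEndingAt n i) (count n 0 i)
paths-cardinality n i = paths n 0 i , paths-unique n 0 i , (λ c → mk⇔ to (from c)) , length-paths n 0 i
  where
  to : ∀ {c} → c ∈ paths n 0 i → ReversedPathEndingAt n i c
  to c∈ = record { starts-at-0 = start p ; steps = steps p ; nonnegative = nonnegative p } , end p
    where p = paths-sound n 0 i c∈
  from : ∀ c → ReversedPathEndingAt n i c → c ∈ paths n 0 i
  from c (p , e) = paths-complete n 0 i c (pathFrom P.starts-at-0 P.steps P.nonnegative e)
    where module P = IsReversedPartialTernaryPath p

-- `count` recurses on the first step, whereas the closed form obeys a recurrence in the end level.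
-- Induction on `n` works because first steps act on `s` and last steps on `i`, and these two
-- operations commute.
count-lastStep : ∀ n s i →
  count (suc n) s i ≡ count n s (suc i) + delay 0 (delay 0 (count n s)) i
-- A single step is both first and last; for `i < 2` it cannot be an up step.
count-lastStep zero zero    zero          = refl
count-lastStep zero (suc s) zero          = sym (+-identityʳ _)
count-lastStep zero zero    (suc zero)    = refl
count-lastStep zero (suc s) (suc zero)    = sym (+-identityʳ _)
count-lastStep zero zero    (suc (suc i)) = +-comm (count 0 0 i) 0
count-lastStep zero (suc s) (suc (suc i)) = +-comm (count 0 (suc s) i) _
count-lastStep (suc n) s i = begin
  count (suc n) (2 + s) i + delay 0 (λ t → count (suc n) t i) s
    ≡⟨ cong₂ _+_ (count-lastStep n (2 + s) i) (down s) ⟩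
  (count n (2 + s) (suc i) + delay² (count n (2 + s)) i) +
  (delay 0 (λ t → count n t (suc i)) s + delay 0 (λ t → delay² (count n t) i) s)
    ≡⟨ interchange (count n (2 + s) (suc i)) _ _ _ ⟩
  count (suc n) s (suc i) + (delay² (count n (2 + s)) i + delay 0 (λ t → delay² (count n t) i) s)
    ≡⟨ cong₂ _+_ (refl {x = count (suc n) s (suc i)}) (swap s i) ⟩
  count (suc n) s (suc i) + delay² (count (suc n) s) i ∎
  where
  open ≡-Reasoning
  delay² : (ℕ → ℕ) → ℕ → ℕ
  delay² f = delay 0 (delay 0 f)
  interchange : ∀ a b c d → (a + b) + (c + d) ≡ (a + c) + (b + d)
  interchange = solve-∀
  down : ∀ s → delay 0 (λ t → count (suc n) t i) s ≡
               delay 0 (λ t → count n t (suc i)) s + delay 0 (λ t → delay² (count n t) i) s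
  down zero    = refl
  down (suc s) = count-lastStep n s i
  swap : ∀ s i → delay² (count n (2 + s)) i + delay 0 (λ t → delay² (count n t) i) s ≡
                 delay² (count (suc n) s) i
  swap zero    zero          = refl
  swap (suc s) zero          = refl
  swap zero    (suc zero)    = refl
  swap (suc s) (suc zero)    = refl
  swap s       (suc (suc i)) = refl

-- The Fibonacci polynomials acting on sequences

-- fibShift h j is S_j applied to h, with x acting as the shift m ↦ m + 1.
fibShift : (ℤ → ℤ) → ℕ → ℤ → ℤ
fibShift h zero          m = h m
fibShift h (suc zero)    m = h m
fibShift h (suc (suc j)) m = fibShift h (suc j) m ℤ.+ fibShift h j (m ℤ.+ 1ℤ)

+-interchange : ∀ a b c d → (a ℤ.+ b) ℤ.+ (c ℤ.+ d) ≡ (a ℤ.+ c) ℤ.+ (b ℤ.+ d)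
+-interchange = ℤ-Solver.solve-∀

m-1+1≡m : ∀ m → m ℤ.- 1ℤ ℤ.+ 1ℤ ≡ m
m-1+1≡m = ℤ-Solver.solve-∀

module _ (h : ℤ → ℤ) where

  -- As a polynomial in the shift x, S_j is linear and commutes with 1 + x⁻¹.
  fibShift-pascal : ∀ {h′} → (∀ m → h′ m ≡ h m ℤ.+ h (m ℤ.- 1ℤ)) →
    ∀ j m → fibShift h′ j m ≡ fibShift h j m ℤ.+ fibShift h j (m ℤ.- 1ℤ)
  fibShift-pascal p zero          m = p m
  fibShift-pascal p (suc zero)    m = p m
  fibShift-pascal p (suc (suc j)) m = trans
    (cong₂ ℤ._+_ (fibShift-pascal p (suc j) m) (fibShift-pascal p j (m ℤ.+ 1ℤ)))
    (trans (+-interchange (fibShift h (suc j) m) _ _ _)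
           (cong (λ l → fibShift h (2 + j) m ℤ.+ (fibShift h (suc j) (m ℤ.- 1ℤ) ℤ.+ fibShift h j l))
                 (commute m)))
    where
    commute : ∀ m → m ℤ.+ 1ℤ ℤ.- 1ℤ ≡ m ℤ.- 1ℤ ℤ.+ 1ℤ
    commute = ℤ-Solver.solve-∀

  -- This is (1+x) S_{j+2} = S_{j+3} + x² S_j divided by x. Unfolding S_{j+2} at `m` and S_{j+3} at
  -- `m - 1` leaves the same three terms on both sides.
  fibShift-lastStep : ∀ j m → fibShift h (2 + j) m ℤ.+ fibShift h (2 + j) (m ℤ.- 1ℤ) ≡
                           fibShift h (3 + j) (m ℤ.- 1ℤ) ℤ.+ fibShift h j (m ℤ.+ 1ℤ)
  fibShift-lastStep j m = trans
    (rearrange (fibShift h (suc j) m) (fibShift h j (m ℤ.+ 1ℤ)) _)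
    (cong (λ l → fibShift h (2 + j) (m ℤ.- 1ℤ) ℤ.+ fibShift h (suc j) l ℤ.+ fibShift h j (m ℤ.+ 1ℤ))
          (sym (m-1+1≡m m)))
    where
    rearrange : ∀ a b c → (a ℤ.+ b) ℤ.+ c ≡ (c ℤ.+ a) ℤ.+ b
    rearrange = ℤ-Solver.solve-∀

  -- S_j has degree ⌊j/2⌋, at most `m` under the bound, so `h` is only evaluated at negative
  -- arguments.
  fibShift-vanishes : (∀ m → h -[1+ m ] ≡ 0ℤ) →
    ∀ j m → j < suc m * 2 → fibShift h j -[1+ m ] ≡ 0ℤ
  fibShift-vanishes z zero          m       lt = z m
  fibShift-vanishes z (suc zero)    m       lt = z m
  fibShift-vanishes z (suc (suc j)) zero    (s≤s (s≤s ()))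
  fibShift-vanishes z (suc (suc j)) (suc m) (s≤s (s≤s lt)) =
    cong₂ ℤ._+_ (fibShift-vanishes z (suc j) (suc m) (s≤s (≤-trans lt (n≤1+n _))))
                (fibShift-vanishes z j m lt)

-- Fibonacci polynomials as binomial sums

sumBelow : ℕ → (ℕ → ℤ) → ℤ
sumBelow zero    f = 0ℤ
sumBelow (suc K) f = f 0 ℤ.+ sumBelow K (f ∘ suc)

sumUpTo≡sumBelow : ∀ m f → sumUpTo m f ≡ sumBelow (suc m) f
sumUpTo≡sumBelow m f = trans (cong (foldr ℤ._+_ 0ℤ) (map-upTo f (suc m))) (go (suc m) f)
  where
  go : ∀ K f → foldr ℤ._+_ 0ℤ (applyUpTo f K) ≡ sumBelow K f
  go zero    f = refl
  go (suc K) f = cong (λ z → f 0 ℤ.+ z) (go K (f ∘ suc))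

sumBelow-cong : ∀ K {f g : ℕ → ℤ} → (∀ k → f k ≡ g k) → sumBelow K f ≡ sumBelow K g
sumBelow-cong zero    e = refl
sumBelow-cong (suc K) e = cong₂ ℤ._+_ (e 0) (sumBelow-cong K (e ∘ suc))

sumBelow-0 : ∀ K {f : ℕ → ℤ} → (∀ k → f k ≡ 0ℤ) → sumBelow K f ≡ 0ℤ
sumBelow-0 zero    e = refl
sumBelow-0 (suc K) e = cong₂ ℤ._+_ (e 0) (sumBelow-0 K (e ∘ suc))

sumBelow-+ : ∀ K (f g : ℕ → ℤ) →
  sumBelow K (λ k → f k ℤ.+ g k) ≡ sumBelow K f ℤ.+ sumBelow K g
sumBelow-+ zero    f g = refl
sumBelow-+ (suc K) f g = trans (cong (λ z → f 0 ℤ.+ g 0 ℤ.+ z) (sumBelow-+ K (f ∘ suc) (g ∘ suc)))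
  (+-interchange (f 0) (g 0) _ _)

-- Because of truncation this also covers k > j, where both sides vanish.
C-∸-pascal : ∀ d j k → (suc j ∸ k) C suc (d + k) ≡ (j ∸ k) C suc (d + k) + (j ∸ k) C (d + k)
C-∸-pascal d j zero = trans (sym (nCk+nC[k+1]≡[n+1]C[k+1] j (d + 0))) (+-comm (j C (d + 0)) _)
C-∸-pascal d zero (suc k) rewrite 0∸n≡0 k | +-suc d k = refl
-- The offset `d` absorbs the decrement of `k`, so the lower indices stay fixed while the truncated
-- differences cancel.
C-∸-pascal d (suc j) (suc k) rewrite +-suc d k = C-∸-pascal (suc d) j k

fibTerm : (ℤ → ℤ) → ℕ → ℤ → ℕ → ℤ
fibTerm h j m k = + ((j ∸ k) C k) ℤ.* h (m ℤ.+ + k)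

-- The bound `K` is left free because S_{j+1} and S_j may have different degrees; the coefficients
-- beyond ⌊j/2⌋ are zero.
fibShift≡sum : ∀ h j m K → ⌊ j /2⌋ ≤ K → fibShift h j m ≡ sumBelow (suc K) (fibTerm h j m)
fibShift≡sum h j m K le = sym (go j m K le)
  where
  open ≡-Reasoning
  first : ∀ m → 1ℤ ℤ.* h (m ℤ.+ 0ℤ) ≡ h m
  first m = trans (ℤ.*-identityˡ _) (cong h (ℤ.+-identityʳ m))
  base : ∀ m K {f : ℕ → ℤ} → (∀ k → f k ≡ 0ℤ) → 1ℤ ℤ.* h (m ℤ.+ 0ℤ) ℤ.+ sumBelow K f ≡ h m
  base m K z = trans (cong₂ ℤ._+_ (first m) (sumBelow-0 K z)) (ℤ.+-identityʳ (h m))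
  go : ∀ j m K → ⌊ j /2⌋ ≤ K → sumBelow (suc K) (fibTerm h j m) ≡ fibShift h j m
  go zero       m K le = base m K (λ k → refl)
  go (suc zero) m K le = base m K
    (λ k → cong (λ l → + (l C suc k) ℤ.* h (m ℤ.+ + suc k)) (0∸n≡0 k))
  go (suc (suc j)) m (suc K) (s≤s le) = begin
    t₀ ℤ.+ sumBelow (suc K) (λ k → fibTerm h (2 + j) m (suc k))
      ≡⟨ cong (λ z → t₀ ℤ.+ z) (sumBelow-cong (suc K) term) ⟩
    t₀ ℤ.+ sumBelow (suc K) (λ k → fibTerm h (suc j) m (suc k) ℤ.+ fibTerm h j (m ℤ.+ 1ℤ) k)
      ≡⟨ cong (λ z → t₀ ℤ.+ z) (sumBelow-+ (suc K) (λ k → fibTerm h (suc j) m (suc k)) (fibTerm h j (m ℤ.+ 1ℤ))) ⟩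
    t₀ ℤ.+ (sumBelow (suc K) (λ k → fibTerm h (suc j) m (suc k)) ℤ.+ sumBelow (suc K) (fibTerm h j (m ℤ.+ 1ℤ)))
      -- `t₀` is also the `k = 0` term of the sum for `suc j`, which it completes.
      ≡⟨ ℤ.+-assoc t₀ _ _ ⟨
    sumBelow (2 + K) (fibTerm h (suc j) m) ℤ.+ sumBelow (suc K) (fibTerm h j (m ℤ.+ 1ℤ))
      ≡⟨ cong₂ ℤ._+_
           (go (suc j) m (suc K) (≤-trans (⌊n/2⌋-mono (n≤1+n (suc j))) (s≤s le)))
           (go j (m ℤ.+ 1ℤ) K le) ⟩
    fibShift h (2 + j) m ∎
    where
    t₀ = 1ℤ ℤ.* h (m ℤ.+ 0ℤ)
    term : ∀ k → fibTerm h (2 + j) m (suc k) ≡ fibTerm h (suc j) m (suc k) ℤ.+ fibTerm h j (m ℤ.+ 1ℤ) k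
    term k = begin
      + ((suc j ∸ k) C suc k) ℤ.* y
        ≡⟨ cong (λ l → + l ℤ.* y) (C-∸-pascal 0 j k) ⟩
      (+ ((j ∸ k) C suc k) ℤ.+ + ((j ∸ k) C k)) ℤ.* y
        ≡⟨ ℤ.*-distribʳ-+ y (+ ((j ∸ k) C suc k)) (+ ((j ∸ k) C k)) ⟩
      + ((j ∸ k) C suc k) ℤ.* y ℤ.+ + ((j ∸ k) C k) ℤ.* y
        ≡⟨ cong (λ l → + ((j ∸ k) C suc k) ℤ.* y ℤ.+ + ((j ∸ k) C k) ℤ.* h l)
                (sym (ℤ.+-assoc m 1ℤ (+ k))) ⟩
      fibTerm h (suc j) m (suc k) ℤ.+ fibTerm h j (m ℤ.+ 1ℤ) k ∎
      where y = h (m ℤ.+ + suc k)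

-- The sequences g n

-- Pascal's rule splits the left side, induction treats both parts, and Pascal's rule reassembles
-- them.
C-absorption : ∀ n k → suc k * (suc n C suc k) ≡ suc n * (n C k)
C-absorption zero    zero    = refl
C-absorption zero    (suc k) = *-comm k 0
C-absorption (suc n) zero    = trans (cong (1 *_) (nC1≡n (2 + n))) (*-comm 1 (2 + n))
C-absorption (suc n) (suc k) = begin
  suc (suc k) * ((2 + n) C (2 + k))
    ≡⟨ cong (suc (suc k) *_) (nCk+nC[k+1]≡[n+1]C[k+1] (suc n) (suc k)) ⟨
  suc (suc k) * (a + suc n C (2 + k))
    ≡⟨ expand k a (suc n C (2 + k)) ⟩
  a + (suc k * a + suc (suc k) * (suc n C (2 + k)))
    ≡⟨ cong₂ (λ b c → a + (b + c)) (C-absorption n k) (C-absorption n (suc k)) ⟩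
  a + (suc n * (n C k) + suc n * (n C suc k))
    ≡⟨ collect n a (n C k) (n C suc k) ⟩
  a + suc n * (n C k + n C suc k)
    ≡⟨ cong (λ l → a + suc n * l) (nCk+nC[k+1]≡[n+1]C[k+1] n k) ⟩
  (2 + n) * a ∎
  where
  open ≡-Reasoning
  a = suc n C suc k
  expand : ∀ k a b → suc (suc k) * (a + b) ≡ a + (suc k * a + suc (suc k) * b)
  expand = solve-∀
  collect : ∀ n a b c → a + (suc n * b + suc n * c) ≡ a + suc n * (b + c)
  collect = solve-∀

binom-pascal : ∀ n m → binom (suc n) m ≡ binom n m ℤ.+ binom n (m ℤ.- 1ℤ)
binom-pascal n (+ zero)   = refl
binom-pascal n (+ suc k)  =
  cong +_ (trans (sym (nCk+nC[k+1]≡[n+1]C[k+1] n k)) (+-comm (n C k) (n C suc k)))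
binom-pascal n -[1+ k ]   = refl

g : ℕ → ℤ → ℤ
g n m = binom (n + 1) m ℤ.- + 3 ℤ.* binom n (m ℤ.- 1ℤ)

g-pascal : ∀ n m → g (suc n) m ≡ g n m ℤ.+ g n (m ℤ.- 1ℤ)
g-pascal n m = trans
  (cong₂ (λ a b → a ℤ.- + 3 ℤ.* b) (binom-pascal (n + 1) m) (binom-pascal n (m ℤ.- 1ℤ)))
  (rearrange (binom (n + 1) m) _ _ _)
  where
  rearrange : ∀ a b c d → (a ℤ.+ b) ℤ.- + 3 ℤ.* (c ℤ.+ d) ≡ (a ℤ.- + 3 ℤ.* c) ℤ.+ (b ℤ.- + 3 ℤ.* d)
  rearrange = ℤ-Solver.solve-∀

-- The hypothesis forces `m` to be positive. Absorption then gives m C(3m,m) = 3m C(3m-1,m-1), and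
-- the factor m cancels.
g-boundary : ∀ n m → + suc n ≡ + 3 ℤ.* m → g n m ≡ 0ℤ
g-boundary n (+ suc m) e = trans
  (cong (λ l → l ℤ.- + 3 ℤ.* + (n C m)) (trans (cong +_ central) (ℤ.pos-* 3 (n C m))))
  (ℤ.+-inverseʳ (+ 3 ℤ.* + (n C m)))
  where
  open ≡-Reasoning
  central : (n + 1) C suc m ≡ 3 * (n C m)
  central = *-cancelˡ-≡ _ _ (suc m) (begin
    suc m * ((n + 1) C suc m) ≡⟨ cong (λ l → suc m * (l C suc m)) (+-comm n 1) ⟩
    suc m * (suc n C suc m)   ≡⟨ C-absorption n m ⟩
    suc n * (n C m)           ≡⟨ cong (_* (n C m)) (ℤ.+-injective e) ⟩
    3 * suc m * (n C m)       ≡⟨ cong (_* (n C m)) (*-comm 3 (suc m)) ⟩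
    suc m * 3 * (n C m)       ≡⟨ *-assoc (suc m) 3 (n C m) ⟩
    suc m * (3 * (n C m))     ∎)

-- Induction on the length. One step less turns (m, j) into (m-1, j+1) or (m+1, j-2), so `m` must
-- range over all integers even though the theorem only needs natural numbers.
count≡fibShift : ∀ n j m → + n ≡ + 3 ℤ.* m ℤ.+ + 2 ℤ.* + j → + count n 0 j ≡ fibShift (g n) j m
count≡fibShift zero zero    (+ zero)  e = refl
count≡fibShift zero zero    (+ suc m) ()
count≡fibShift zero zero    -[1+ m ]  ()
count≡fibShift zero (suc j) (+ zero)  ()
count≡fibShift zero (suc j) (+ suc m) ()
-- Length 0 gives 2(j+1) = 3(m+1) < 4(m+1), hence j+1 < 2(m+1), the bound under which the closed
-- form vanishes.
count≡fibShift zero (suc j) -[1+ m ]  e =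
  sym (fibShift-vanishes (g 0) (λ _ → refl) (suc j) m (*-cancelʳ-< 2 (suc j) (suc m * 2) small))
  where
  negate : ∀ x y → + 3 ℤ.* x ℤ.+ (+ 3 ℤ.* (ℤ.- x) ℤ.+ y) ≡ y
  negate = ℤ-Solver.solve-∀
  balance : 3 * suc m ≡ 2 * suc j
  balance = ℤ.+-injective (trans (sym (ℤ.+-identityʳ _))
    (trans (cong (λ z → + 3 ℤ.* + suc m ℤ.+ z) e) (negate (+ suc m) (+ 2 ℤ.* + suc j))))
  small : suc j * 2 < suc m * 2 * 2
  small = begin-strict
    suc j * 2           ≡⟨ *-comm (suc j) 2 ⟩
    2 * suc j           ≡⟨ balance ⟨
    3 * suc m           <⟨ m<n+m (3 * suc m) (s≤s z≤n) ⟩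
    suc m + 3 * suc m   ≡⟨ quadruple (suc m) ⟩
    suc m * 2 * 2       ∎
    where
    open ≤-Reasoning
    quadruple : ∀ x → x + 3 * x ≡ x * 2 * 2
    quadruple = solve-∀
count≡fibShift (suc n) j m e = begin
  + count (suc n) 0 j
    ≡⟨ cong +_ (count-lastStep n 0 j) ⟩
  + count n 0 (suc j) ℤ.+ + delay 0 (delay 0 (count n 0)) j
    ≡⟨ cong (ℤ._+ _) (count≡fibShift n (suc j) (m ℤ.- 1ℤ) (trans (cong (ℤ._- 1ℤ) e) (down m (+ j)))) ⟩
  fibShift (g n) (suc j) (m ℤ.- 1ℤ) ℤ.+ + delay 0 (delay 0 (count n 0)) j
    ≡⟨ recurrence j e ⟩
  fibShift (g n) j m ℤ.+ fibShift (g n) j (m ℤ.- 1ℤ)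
    ≡⟨ fibShift-pascal (g n) (g-pascal n) j m ⟨
  fibShift (g (suc n)) j m ∎
  where
  open ≡-Reasoning
  down : ∀ m x → + 3 ℤ.* m ℤ.+ + 2 ℤ.* x ℤ.- 1ℤ ≡ + 3 ℤ.* (m ℤ.- 1ℤ) ℤ.+ + 2 ℤ.* (1ℤ ℤ.+ x)
  down = ℤ-Solver.solve-∀
  up : ∀ m x → + 3 ℤ.* m ℤ.+ + 2 ℤ.* (+ 2 ℤ.+ x) ℤ.- 1ℤ ≡ + 3 ℤ.* (m ℤ.+ 1ℤ) ℤ.+ + 2 ℤ.* x
  up = ℤ-Solver.solve-∀
  recurrence : ∀ j → + suc n ≡ + 3 ℤ.* m ℤ.+ + 2 ℤ.* + j →
    fibShift (g n) (suc j) (m ℤ.- 1ℤ) ℤ.+ + delay 0 (delay 0 (count n 0)) j ≡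
    fibShift (g n) j m ℤ.+ fibShift (g n) j (m ℤ.- 1ℤ)
  -- No up step ends at level 0, so the extra term `g n m` has to vanish.
  recurrence zero e = trans (ℤ.+-comm (g n (m ℤ.- 1ℤ)) 0ℤ)
    (cong (ℤ._+ g n (m ℤ.- 1ℤ)) (sym (g-boundary n m (trans e (ℤ.+-identityʳ _)))))
  -- S₋₁ = 0: there is no up-step term, and S₂ already yields both summands.
  recurrence (suc zero) e = trans (ℤ.+-identityʳ _)
    (trans (cong (λ l → g n (m ℤ.- 1ℤ) ℤ.+ g n l) (m-1+1≡m m)) (ℤ.+-comm (g n (m ℤ.- 1ℤ)) (g n m)))
  recurrence (suc (suc j)) e = trans
    (cong (λ z → fibShift (g n) (3 + j) (m ℤ.- 1ℤ) ℤ.+ z)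
          (count≡fibShift n j (m ℤ.+ 1ℤ) (trans (cong (ℤ._- 1ℤ) e) (up m (+ j)))))
    (sym (fibShift-lastStep (g n) j m))

mainTheorem2 : (N i : ℕ) → Σ[ m ∈ ℕ ] (HasCardinality (ReversedPathEndingAt (3 * N + 2 * i) i) m × + m ≡ pathFormula N i)
mainTheorem2 N i = count n 0 i , paths-cardinality n i , (begin
  + count n 0 i                                   ≡⟨ count≡fibShift n i (+ N) length≡ ⟩
  fibShift (g n) i (+ N)                          ≡⟨ fibShift≡sum (g n) i (+ N) ⌊ i /2⌋ ≤-refl ⟩
  -- At `m = + N` the summand unfolds to that of `pathFormula`; `suc` turns the inclusive bound into
  -- a number of terms.
  sumBelow (suc ⌊ i /2⌋) (fibTerm (g n) i (+ N))  ≡⟨ sumUpTo≡sumBelow ⌊ i /2⌋ (fibTerm (g n) i (+ N)) ⟨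
  pathFormula N i                                 ∎)
  where
  open ≡-Reasoning
  n = 3 * N + 2 * i
  length≡ : + n ≡ + 3 ℤ.* + N ℤ.+ + 2 ℤ.* + i
  length≡ = cong₂ ℤ._+_ (ℤ.pos-* 3 N) (ℤ.pos-* 2 i)
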